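{- Let $a$ be a tile of an additive poset $A$ and let $I$ be the set of all atoms of $A$ lying in the tail $A_a$. Then the map $2^I_f\to A$, $J\mapsto\sum_{j\in J} j$, is an isomorphism of additive posets from the restricted additive powerset $2^I_f$ onto the additive subposet of $A_a$ generated by $I$ as a $\mathbb{Z}/2\mathbb{Z}$-vector space.
   Context: An additive poset is a pair $(A,\le)$ where $A$ is an abelian group and $\le$ is a partial order on $A$ such that for all $a,b,c\in A$: $(\ast)$ if $b\le a$ and $c\le a$ then $b+c\le a$; $(\ast\ast)$ if $a\le b$ and $a\le c$ then $a\le a+b+c$. Every subgroup with the restricted order is an additive poset (an additive subposet). An isomorphism of additive posets is a bijection that is both a group isomorphism and an order isomorphism. The tail of $a$ is $A_a=\{x:x\le a\}$. Elements $x,y$ are independent if $x\le x+y$. An atom is a nonzero $x$ with $A_x=\{0,x\}$. A tile is a nonzero $a$ such that any two distinct atoms of $A$ in $A_a$ are independent. For a set $I$, $2^I_f$ is the set of finite subsets of $I$ with symmetric difference as addition and inclusion as partial order. -}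

module Defs where

open import Algebra.Bundles using (AbelianGroup; Ring)
open import Algebra.Module.Bundles using (LeftModule)
open import Algebra.Morphism.Structures using (module GroupMorphisms)
import Algebra.Properties.Group as GroupProperties
open import Axiom.ExcludedMiddle using (ExcludedMiddle)
open import Data.Empty using (⊥-elim)
open import Data.Empty.Polymorphic using () renaming (⊥ to ⊥ₚ)
open import Data.List.Base using (List; []; _∷_; _++_; filter; foldr; map)
import Data.List.Membership.DecSetoid as DecMembership
import Data.List.Membership.Setoid as Membership
open import Data.List.Membership.Setoid.Properties using (∈-resp-≈; ∈-++⁺ˡ; ∈-++⁺ʳ; ∈-++⁻; ∈-filter⁺; ∈-filter⁻)
open import Data.List.Relation.Unary.AllPairs using ([])
open import Data.List.Relation.Unary.Unique.Setoid using (Unique)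
import Data.List.Relation.Unary.Unique.Setoid.Properties as Uniqueₚ
open import Data.Parity.Base as ℙ using (Parity; 0ℙ; 1ℙ)
import Data.Parity.Properties as ℙₚ
open import Data.Product.Base using (Σ; _×_; _,_; proj₁; proj₂)
open import Data.Sum.Base using (_⊎_; inj₁; inj₂)
open import Function.Base using (_on_; _∘_; id)
open import Function.Bundles using (_⇔_; mk⇔; module Equivalence)
open import Level using (Level; _⊔_; suc)
open import Relation.Binary.Bundles using (DecSetoid)
open import Relation.Binary.Core using (Rel)
open import Relation.Binary.Morphism.Structures using (IsOrderIsomorphism)
open import Relation.Binary.PropositionalEquality.Core using (refl)
open import Relation.Binary.Structures using (IsEquivalence; IsPartialOrder)
open import Relation.Nullary.Decidable.Core using (Dec; yes; no; map′; ¬?)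
open import Relation.Nullary.Negation.Core using (¬_)
open import Relation.Unary using (Pred; _∈_; _⊆_; _∪_; _∖_)

private
  variable
    c c′ ℓ ℓ₁ ℓ₁′ ℓ₂ ℓ₂′ m ℓm p r ℓr : Level

record AdditivePoset (c ℓ₁ ℓ₂ : Level) : Set (suc (c ⊔ ℓ₁ ⊔ ℓ₂)) where
  infix 4 _≤_
  field
    abelianGroup : AbelianGroup c ℓ₁

  open AbelianGroup abelianGroup public
    renaming ( _∙_ to infixl 6 _+_; ε to 0#; _⁻¹ to infix 8 -_
             ; ∙-cong to +-cong; ∙-congˡ to +-congˡ; ∙-congʳ to +-congʳ
             ; assoc to +-assoc; comm to +-comm
             ; identityˡ to +-identityˡ; identityʳ to +-identityʳ
             ; inverseˡ to -‿inverseˡ; inverseʳ to -‿inverseʳ; ⁻¹-cong to -‿cong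
             ; refl to ≈-refl; sym to ≈-sym; trans to ≈-trans )

  field
    _≤_            : Rel Carrier ℓ₂
    isPartialOrder : IsPartialOrder _≈_ _≤_
    *-law          : ∀ {a b c} → b ≤ a → c ≤ a → b + c ≤ a
    **-law         : ∀ {a b c} → a ≤ b → a ≤ c → a ≤ (a + b) + c

  open IsPartialOrder isPartialOrder public
    using (≤-respˡ-≈; ≤-respʳ-≈)
    renaming (refl to ≤-refl; trans to ≤-trans; antisym to ≤-antisym; reflexive to ≤-reflexive)

record IsAdditivePosetIsomorphism
  (A : AdditivePoset c ℓ₁ ℓ₂) (B : AdditivePoset c′ ℓ₁′ ℓ₂′)
  (f : AdditivePoset.Carrier A → AdditivePoset.Carrier B)
  : Set (c ⊔ ℓ₁ ⊔ ℓ₂ ⊔ c′ ⊔ ℓ₁′ ⊔ ℓ₂′) where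
  private
    module A = AdditivePoset A
    module B = AdditivePoset B
  open GroupMorphisms A.rawGroup B.rawGroup using (IsGroupIsomorphism)
  field
    isGroupIsomorphism : IsGroupIsomorphism f
    isOrderIsomorphism : IsOrderIsomorphism A._≈_ B._≈_ A._≤_ B._≤_ f

module _ (A : AdditivePoset c ℓ₁ ℓ₂) where
  open AdditivePoset A

  Tail : Carrier → Pred Carrier ℓ₂
  Tail a x = x ≤ a

  Independent : Rel Carrier ℓ₂
  Independent x y = x ≤ x + y

  record IsAtom (x : Carrier) : Set (c ⊔ ℓ₁ ⊔ ℓ₂) where
    field
      nonzero : ¬ x ≈ 0#
      tail    : ∀ y → y ∈ Tail x ⇔ (y ≈ 0# ⊎ y ≈ x)

  AtomsInTail : Carrier → Pred Carrier (c ⊔ ℓ₁ ⊔ ℓ₂)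
  AtomsInTail a x = IsAtom x × x ∈ Tail a

  record IsTile (a : Carrier) : Set (c ⊔ ℓ₁ ⊔ ℓ₂) where
    field
      nonzero     : ¬ a ≈ 0#
      independent : ∀ {x y} → x ∈ AtomsInTail a → y ∈ AtomsInTail a →
                    ¬ x ≈ y → Independent x y

  record IsSubgroup (P : Pred Carrier p) : Set (c ⊔ ℓ₁ ⊔ p) where
    field
      resp : ∀ {x y} → x ≈ y → P x → P y
      0∈   : P 0#
      +∈   : ∀ {x y} → P x → P y → P (x + y)
      -∈   : ∀ {x} → P x → P (- x)

  subposet : (P : Pred Carrier p) → IsSubgroup P → AdditivePoset (c ⊔ p) ℓ₁ ℓ₂
  subposet P S = record
    { abelianGroup = record
      { Carrier        = Σ Carrier P
      ; _≈_            = _≈_ on proj₁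
      ; _∙_            = λ (x , px) (y , py) → x + y , +∈ px py
      ; ε              = 0# , 0∈
      ; _⁻¹            = λ (x , px) → - x , -∈ px
      ; isAbelianGroup = record
        { isGroup = record
          { isMonoid = record
            { isSemigroup = record
              { isMagma = record
                { isEquivalence = record { refl = ≈-refl ; sym = ≈-sym ; trans = ≈-trans }
                ; ∙-cong        = +-cong
                }
              ; assoc = λ _ _ _ → +-assoc _ _ _
              }
            ; identity = (λ _ → +-identityˡ _) , (λ _ → +-identityʳ _)
            }
          ; inverse = (λ _ → -‿inverseˡ _) , (λ _ → -‿inverseʳ _)
          ; ⁻¹-cong = -‿cong
          }
        ; comm = λ _ _ → +-comm _ _
        }
      }
    ; _≤_            = _≤_ on proj₁
    ; isPartialOrder = record
      { isPreorder = record
        { isEquivalence = record { refl = ≈-refl ; sym = ≈-sym ; trans = ≈-trans }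
        ; reflexive     = ≤-reflexive
        ; trans         = ≤-trans
        }
      ; antisym = ≤-antisym
      }
    ; *-law          = *-law
    ; **-law         = **-law
    }
    where open IsSubgroup S

  -- 2x ≤ x, hence 3x ≤ x; also x ≤ 3x, so antisymmetry gives 3x = x.
  x+x≈0 : ∀ x → x + x ≈ 0#
  x+x≈0 x = identityʳ-unique x (x + x) (≈-trans (≈-sym (+-assoc x x x)) 3x≈x)
    where
    open GroupProperties group using (identityʳ-unique)
    3x≈x : (x + x) + x ≈ x
    3x≈x = ≤-antisym (*-law (*-law ≤-refl ≤-refl) ≤-refl) (**-law ≤-refl ≤-refl)

  0≤ : ∀ x → 0# ≤ x
  0≤ x = ≤-respˡ-≈ (x+x≈0 x) (*-law ≤-refl ≤-refl)

  -x≈x : ∀ x → x ≈ - x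
  -x≈x x = inverseˡ-unique x x (x+x≈0 x)
    where open GroupProperties group using (inverseˡ-unique)

  tail-isSubgroup : ∀ a → IsSubgroup (Tail a)
  tail-isSubgroup a = record
    { resp = ≤-respˡ-≈
    ; 0∈   = 0≤ a
    ; +∈   = *-law
    ; -∈   = ≤-respˡ-≈ (-x≈x _)
    }

  tailPoset : Carrier → AdditivePoset (c ⊔ ℓ₂) ℓ₁ ℓ₂
  tailPoset a = subposet (Tail a) (tail-isSubgroup a)

  _·_ : Parity → Carrier → Carrier
  0ℙ · x = 0#
  1ℙ · x = x

  -- ℤ/2ℤ is the ring of parities.
  vectorSpace : LeftModule ℙₚ.+-*-ring c ℓ₁
  vectorSpace = record
    { Carrierᴹ     = Carrier
    ; _≈ᴹ_         = _≈_
    ; _+ᴹ_         = _+_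
    ; _*ₗ_         = _·_
    ; 0ᴹ           = 0#
    ; -ᴹ_          = -_
    ; isLeftModule = record
      { isLeftSemimodule = record
        { +ᴹ-isCommutativeMonoid = isCommutativeMonoid
        ; isPreleftSemimodule    = record
          { *ₗ-cong      = λ { {0ℙ} refl _ → ≈-refl ; {1ℙ} refl x≈y → x≈y }
          ; *ₗ-zeroˡ     = λ _ → ≈-refl
          ; *ₗ-distribʳ  = distribʳ
          ; *ₗ-identityˡ = λ _ → ≈-refl
          ; *ₗ-assoc     = λ { 0ℙ _ _ → ≈-refl ; 1ℙ _ _ → ≈-refl }
          ; *ₗ-zeroʳ     = λ { 0ℙ → ≈-refl ; 1ℙ → ≈-refl }
          ; *ₗ-distribˡ  = λ { 0ℙ _ _ → ≈-sym (+-identityˡ 0#) ; 1ℙ _ _ → ≈-refl }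
          }
        }
      ; -ᴹ‿cong          = -‿cong
      ; -ᴹ‿inverse       = -‿inverseˡ , -‿inverseʳ
      }
    }
    where
    distribʳ : ∀ x s t → ((s ℙ.+ t) · x) ≈ ((s · x) + (t · x))
    distribʳ x 0ℙ t  = ≈-sym (+-identityˡ _)
    distribʳ x 1ℙ 0ℙ = ≈-sym (+-identityʳ _)
    distribʳ x 1ℙ 1ℙ = ≈-sym (x+x≈0 x)

-- The submodule generated by a subset X.
module _ {R : Ring r ℓr} (M : LeftModule R m ℓm) where
  open LeftModule M

  data Span (X : Pred Carrierᴹ p) : Pred Carrierᴹ (r ⊔ m ⊔ ℓm ⊔ p) where
    generator : ∀ {x} → X x → Span X x
    zero      : Span X 0ᴹ
    add       : ∀ {x y} → Span X x → Span X y → Span X (x +ᴹ y)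
    scale     : ∀ s {x} → Span X x → Span X (s *ₗ x)
    resp      : ∀ {x y} → x ≈ᴹ y → Span X x → Span X y

module _ (A : AdditivePoset c ℓ₁ ℓ₂) where
  open AdditivePoset A

  span-isSubgroup : (X : Pred Carrier p) → IsSubgroup A (Span (vectorSpace A) X)
  span-isSubgroup X = record
    { resp = resp
    ; 0∈   = zero
    ; +∈   = add
    ; -∈   = λ {x} → resp (-x≈x A x)
    }

  generated : Pred Carrier p → AdditivePoset (c ⊔ ℓ₁ ⊔ p) ℓ₁ ℓ₂
  generated X = subposet A (Span (vectorSpace A) X) (span-isSubgroup X)

-- Equality of the index set must be decidable for symmetric differences
-- of finite subsets to be enumerable.
module RestrictedPowerset (I : DecSetoid c ℓ) where
  open DecSetoid I using (Carrier; setoid)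
  open Membership setoid using () renaming (_∈_ to _∈ₗ_)
  open DecMembership I using (_∈?_)

  -- The enumeration is not part of the identity of a finite subset: see _≐_.
  record FiniteSubset : Set (suc (c ⊔ ℓ)) where
    field
      subset     : Pred Carrier (c ⊔ ℓ)
      elements   : List Carrier
      unique     : Unique setoid elements
      enumerates : ∀ {x} → subset x ⇔ x ∈ₗ elements

    subset? : ∀ x → Dec (subset x)
    subset? x = map′ from to (x ∈? elements)
      where open Equivalence enumerates

  open FiniteSubset

  ∅ : FiniteSubset
  ∅ = record
    { subset     = λ _ → ⊥ₚ
    ; elements   = []
    ; unique     = []
    ; enumerates = mk⇔ (λ ()) (λ ())
    }

  infixl 6 _∆_
  _∆_ : FiniteSubset → FiniteSubset → FiniteSubset
  J ∆ K = record
    { subset     = (subset J ∖ subset K) ∪ (subset K ∖ subset J)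
    ; elements   = J∖K ++ K∖J
    ; unique     = Uniqueₚ.++⁺ setoid
                     (Uniqueₚ.filter⁺ setoid (¬? ∘ subset? K) (unique J))
                     (Uniqueₚ.filter⁺ setoid (¬? ∘ subset? J) (unique K))
                     (λ (v∈J∖K , v∈K∖J) → proj₂ (diff⁻ K J v∈K∖J) (proj₁ (diff⁻ J K v∈J∖K)))
    ; enumerates = mk⇔
        (λ { (inj₁ v∈) → ∈-++⁺ˡ setoid (diff⁺ J K v∈)
           ; (inj₂ v∈) → ∈-++⁺ʳ setoid J∖K (diff⁺ K J v∈) })
        (λ v∈ → case-++ (∈-++⁻ setoid J∖K v∈))
    }
    where
    J∖K K∖J : List Carrier
    J∖K = filter (¬? ∘ subset? K) (elements J)
    K∖J = filter (¬? ∘ subset? J) (elements K)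

    subset-resp : ∀ L {x y} → DecSetoid._≈_ I x y → subset L x → subset L y
    subset-resp L x≈y = Equivalence.from (enumerates L) ∘ ∈-resp-≈ setoid x≈y ∘ Equivalence.to (enumerates L)

    ∉-resp : ∀ L {x y} → DecSetoid._≈_ I x y → ¬ subset L x → ¬ subset L y
    ∉-resp L x≈y x∉ y∈ = x∉ (subset-resp L (DecSetoid.sym I x≈y) y∈)

    diff⁺ : ∀ L M {v} → (subset L ∖ subset M) v → v ∈ₗ filter (¬? ∘ subset? M) (elements L)
    diff⁺ L M (v∈L , v∉M) = ∈-filter⁺ setoid (¬? ∘ subset? M) (∉-resp M) (Equivalence.to (enumerates L) v∈L) v∉M

    diff⁻ : ∀ L M {v} → v ∈ₗ filter (¬? ∘ subset? M) (elements L) → (subset L ∖ subset M) v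
    diff⁻ L M v∈ with ∈-filter⁻ setoid (¬? ∘ subset? M) (∉-resp M) v∈
    ... | v∈L , v∉M = Equivalence.from (enumerates L) v∈L , v∉M

    case-++ : ∀ {v} → (v ∈ₗ J∖K) ⊎ (v ∈ₗ K∖J) → ((subset J ∖ subset K) ∪ (subset K ∖ subset J)) v
    case-++ (inj₁ v∈) = inj₁ (diff⁻ J K v∈)
    case-++ (inj₂ v∈) = inj₂ (diff⁻ K J v∈)

  infix 4 _≐_ _⊑_
  _⊑_ _≐_ : Rel FiniteSubset (c ⊔ ℓ)
  J ⊑ K = subset J ⊆ subset K
  J ≐ K = J ⊑ K × K ⊑ J

  private
    ∆-comm : ∀ J K → J ∆ K ≐ K ∆ J
    ∆-comm J K = swap , swap
      where
      swap : ∀ {P Q : Set (c ⊔ ℓ)} → P ⊎ Q → Q ⊎ P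
      swap (inj₁ x) = inj₂ x
      swap (inj₂ y) = inj₁ y

    ∆-cong : ∀ {J J′ K K′} → J ≐ J′ → K ≐ K′ → J ∆ K ≐ J′ ∆ K′
    ∆-cong (J⊑J′ , J′⊑J) (K⊑K′ , K′⊑K) =
        (λ { (inj₁ (a , b)) → inj₁ (J⊑J′ a , b ∘ K′⊑K) ; (inj₂ (a , b)) → inj₂ (K⊑K′ a , b ∘ J′⊑J) })
      , (λ { (inj₁ (a , b)) → inj₁ (J′⊑J a , b ∘ K⊑K′) ; (inj₂ (a , b)) → inj₂ (K′⊑K a , b ∘ J⊑J′) })

    ∆-assoc-⊑ : ∀ J K L → (J ∆ K) ∆ L ⊑ J ∆ (K ∆ L)
    ∆-assoc-⊑ J K L (inj₁ (inj₁ (j , ¬k) , ¬l)) = inj₁ (j , λ { (inj₁ (k , _)) → ¬k k ; (inj₂ (l , _)) → ¬l l })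
    ∆-assoc-⊑ J K L (inj₁ (inj₂ (k , ¬j) , ¬l)) = inj₂ (inj₁ (k , ¬l) , ¬j)
    ∆-assoc-⊑ J K L {x} (inj₂ (l , ¬jk)) with subset? J x | subset? K x
    ... | yes j | yes k = inj₁ (j , λ { (inj₁ (_ , ¬l)) → ¬l l ; (inj₂ (_ , ¬k)) → ¬k k })
    ... | yes j | no ¬k = ⊥-elim (¬jk (inj₁ (j , ¬k)))
    ... | no ¬j | yes k = ⊥-elim (¬jk (inj₂ (k , ¬j)))
    ... | no ¬j | no ¬k = inj₂ (inj₂ (l , ¬k) , ¬j)

    ∆-assoc : ∀ J K L → (J ∆ K) ∆ L ≐ J ∆ (K ∆ L)
    ∆-assoc J K L = ∆-assoc-⊑ J K L , λ x∈ →
      reverse (∆-assoc-⊑ L K J (proj₁ (∆-comm J (L ∆ K)) (proj₁ (∆-cong {J} {J} {K ∆ L} {L ∆ K} (id , id) (∆-comm K L)) x∈)))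
      where
      reverse : L ∆ (K ∆ J) ⊑ (J ∆ K) ∆ L
      reverse x∈ = proj₁ (∆-comm L (J ∆ K)) (proj₁ (∆-cong {L} {L} {K ∆ J} {J ∆ K} (id , id) (∆-comm K J)) x∈)
    ∆-identityˡ : ∀ J → ∅ ∆ J ≐ J
    ∆-identityˡ J = (λ { (inj₂ (x∈J , _)) → x∈J }) , (λ x∈J → inj₂ (x∈J , λ ()))

    ∆-identityʳ : ∀ J → J ∆ ∅ ≐ J
    ∆-identityʳ J = (λ { (inj₁ (x∈J , _)) → x∈J }) , (λ x∈J → inj₁ (x∈J , λ ()))

    ∆-self : ∀ J → J ∆ J ≐ ∅
    ∆-self J = (λ { (inj₁ (a , b)) → ⊥-elim (b a) ; (inj₂ (a , b)) → ⊥-elim (b a) }) , λ ()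

    ∆-** : ∀ {J K L} → J ⊑ K → J ⊑ L → J ⊑ (J ∆ K) ∆ L
    ∆-** J⊑K J⊑L x∈J = inj₂ (J⊑L x∈J , λ { (inj₁ (_ , x∉K)) → x∉K (J⊑K x∈J) ; (inj₂ (_ , x∉J)) → x∉J x∈J })

  restrictedPowerset : AdditivePoset (suc (c ⊔ ℓ)) (c ⊔ ℓ) (c ⊔ ℓ)
  restrictedPowerset = record
    { abelianGroup   = record
      { Carrier        = FiniteSubset
      ; _≈_            = _≐_
      ; _∙_            = _∆_
      ; ε              = ∅
      ; _⁻¹            = id
      ; isAbelianGroup = record
        { isGroup = record
          { isMonoid = record
            { isSemigroup = record
              { isMagma = record
                { isEquivalence = ≐-isEquivalence
                ; ∙-cong        = λ {J} {J′} {K} {K′} → ∆-cong {J} {J′} {K} {K′}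
                }
              ; assoc = ∆-assoc
              }
            ; identity = ∆-identityˡ , ∆-identityʳ
            }
          ; inverse = ∆-self , ∆-self
          ; ⁻¹-cong = id
          }
        ; comm = ∆-comm
        }
      }
    ; _≤_            = _⊑_
    ; isPartialOrder = record
      { isPreorder = record
        { isEquivalence = ≐-isEquivalence
        ; reflexive     = λ J≐K x∈ → proj₁ J≐K x∈
        ; trans         = λ J⊑K K⊑L x∈ → K⊑L (J⊑K x∈)
        }
      ; antisym = λ J⊑K K⊑J → (λ x∈ → J⊑K x∈) , (λ x∈ → K⊑J x∈)
      }
    ; *-law          = λ K⊑J L⊑J → λ { (inj₁ (a , _)) → K⊑J a ; (inj₂ (a , _)) → L⊑J a }
    ; **-law         = λ {J} {K} {L} → ∆-** {J} {K} {L}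
    }
    where
    ≐-isEquivalence : IsEquivalence _≐_
    ≐-isEquivalence = record
      { refl  = (λ x∈ → x∈) , (λ x∈ → x∈)
      ; sym   = λ (J⊑K , K⊑J) → (λ x∈ → K⊑J x∈) , (λ x∈ → J⊑K x∈)
      ; trans = λ (J⊑K , K⊑J) (K⊑L , L⊑K) → (λ x∈ → K⊑L (J⊑K x∈)) , (λ x∈ → K⊑J (L⊑K x∈))
      }

open RestrictedPowerset public using (FiniteSubset; restrictedPowerset)

module _ (A : AdditivePoset c ℓ₁ ℓ₂) where
  open AdditivePoset A

  -- Excluded middle only serves to decide equality of atoms.
  atomsInTail : ExcludedMiddle ℓ₁ → Carrier → DecSetoid (c ⊔ ℓ₁ ⊔ ℓ₂) ℓ₁
  atomsInTail em a = record
    { Carrier          = Σ Carrier (AtomsInTail A a)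
    ; _≈_              = _≈_ on proj₁
    ; isDecEquivalence = record
      { isEquivalence = record { refl = ≈-refl ; sym = ≈-sym ; trans = ≈-trans }
      ; _≟_           = λ _ _ → em
      }
    }

  generatedByAtoms : Carrier → AdditivePoset (c ⊔ ℓ₁ ⊔ ℓ₂) ℓ₁ ℓ₂
  generatedByAtoms a = generated (tailPoset A a) (λ x → proj₁ x ∈ AtomsInTail A a)

  ∑ : {X : Pred Carrier p} → List (Σ Carrier X) → Carrier
  ∑ xs = foldr _+_ 0# (map proj₁ xs)

  ∑∈Tail : ∀ a (xs : List (Σ Carrier (AtomsInTail A a))) → ∑ xs ∈ Tail A a
  ∑∈Tail a []                    = 0≤ A a
  ∑∈Tail a ((_ , _ , x≤a) ∷ xs) = *-law x≤a (∑∈Tail a xs)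

  ∑∈Span : ∀ a (xs : List (Σ Carrier (AtomsInTail A a))) →
           Span (vectorSpace (tailPoset A a)) (λ x → proj₁ x ∈ AtomsInTail A a) (∑ xs , ∑∈Tail a xs)
  ∑∈Span a []                          = zero
  ∑∈Span a ((x , x-atom , x≤a) ∷ xs) = add (generator {x = x , x≤a} (x-atom , x≤a)) (∑∈Span a xs)

  -- J ↦ ∑_{j ∈ J} j, corestricted to the subposet generated by the atoms in the tail of a.
  sumMap : (em : ExcludedMiddle ℓ₁) (a : Carrier) →
           FiniteSubset (atomsInTail em a) → AdditivePoset.Carrier (generatedByAtoms a)
  sumMap em a J = (∑ xs , ∑∈Tail a xs) , ∑∈Span a xs
    where xs = FiniteSubset.elements J

{-# OPTIONS --safe #-}
-- Independence of x from y and z passes to y + z by (∗∗), so an atom x in the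
-- tail of the tile is independent of ∑ K whenever x ∉ K.  Hence x ≤ ∑ K if
-- x ∈ K; and if x ∉ K, then x ≤ ∑ K would give x ≤ x + ∑ K + (x + ∑ K) = 0 by
-- (∗∗), which is absurd.  So J ⊆ K iff ∑ J ≤ ∑ K, which makes the sum map
-- well defined, injective and an order embedding.
module Submission where

open import Defs
open import Axiom.ExcludedMiddle using (ExcludedMiddle)
open import Level using (Level)

import Algebra.Properties.CommutativeSemigroup as CommutativeSemigroupProperties
open import Data.List.Base using (List; []; _∷_; [_]; _++_; filter)
import Data.List.Membership.DecSetoid as DecMembership
import Data.List.Membership.Setoid as Membership
open import Data.List.Membership.Setoid.Properties using (∈-filter⁺; ∈-filter⁻; ∈-resp-≈)
open import Data.List.Relation.Unary.All using ([])
open import Data.List.Relation.Unary.All.Properties using (All¬⇒¬Any)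
open import Data.List.Relation.Unary.AllPairs using ([]; _∷_)
open import Data.List.Relation.Unary.Any using (here; there)
open import Data.List.Relation.Unary.Unique.Setoid using (Unique)
import Data.List.Relation.Binary.Subset.Setoid as Subset
import Data.List.Relation.Unary.Unique.Setoid.Properties as Uniqueₚ
open import Data.Parity.Base using (0ℙ; 1ℙ)
open import Data.Product.Base using (Σ; ∃; _,_; proj₁; proj₂)
open import Function.Base using (_∘_; id)
open import Function.Bundles using (mk⇔; module Equivalence)
open import Relation.Binary.Bundles using (DecSetoid)
import Relation.Binary.Reasoning.Setoid as SetoidReasoning
open import Relation.Nullary.Decidable.Core using (yes; no; ¬?)
open import Relation.Nullary.Negation.Core using (contradiction)
open import Relation.Unary using (Pred; Decidable)

private
  variable
    c ℓ ℓ₁ ℓ₂ p q : Level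

module _ (A : AdditivePoset c ℓ₁ ℓ₂) where
  open AdditivePoset A
  open CommutativeSemigroupProperties commutativeSemigroup using (x∙yz≈y∙xz; interchange)
  open SetoidReasoning setoid

  x+[x+y]≈y : ∀ x y → x + (x + y) ≈ y
  x+[x+y]≈y x y = begin
    x + (x + y)  ≈⟨ +-assoc x x y ⟨
    (x + x) + y  ≈⟨ +-congʳ (x+x≈0 A x) ⟩
    0# + y       ≈⟨ +-identityˡ y ⟩
    y            ∎

  ≤0⇒≈0 : ∀ {x} → x ≤ 0# → x ≈ 0#
  ≤0⇒≈0 {x} x≤0 = ≤-antisym x≤0 (0≤ A x)

  -- By (∗), the tail of `x + y` is closed under addition; containing `x` and `x + y`, it also
  -- contains their sum, which is `y`.
  independent-sym : ∀ {x y} → Independent A x y → Independent A y x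
  independent-sym {x} {y} x≤x+y =
    ≤-respʳ-≈ (+-comm x y) (≤-respˡ-≈ (x+[x+y]≈y x y) (*-law x≤x+y ≤-refl))

  independent-0 : ∀ x → Independent A x 0#
  independent-0 x = ≤-reflexive (≈-sym (+-identityʳ x))

  -- Applied to `x + y` and `x + z`, (∗∗) produces three copies of `x`, two of which cancel.
  independent-+ : ∀ {x y z} → Independent A x y → Independent A x z → Independent A x (y + z)
  independent-+ {x} {y} {z} x≤x+y x≤x+z = ≤-respʳ-≈ eq (**-law x≤x+y x≤x+z)
    where
    eq : (x + (x + y)) + (x + z) ≈ x + (y + z)
    eq = begin
      (x + (x + y)) + (x + z)  ≈⟨ +-congʳ (x+[x+y]≈y x y) ⟩
      y + (x + z)              ≈⟨ x∙yz≈y∙xz y x z ⟩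
      x + (y + z)              ∎

  independent-≤⇒≈0 : ∀ {x y} → Independent A x y → x ≤ y → x ≈ 0#
  independent-≤⇒≈0 {x} {y} x≤x+y x≤y =
    ≤0⇒≈0 (≤-respʳ-≈ (x+x≈0 A (x + y)) (**-law x≤y x≤x+y))

  ∑-++ : {X : Pred Carrier p} (xs ys : List (Σ Carrier X)) → ∑ A (xs ++ ys) ≈ ∑ A xs + ∑ A ys
  ∑-++ []       ys = ≈-sym (+-identityˡ _)
  ∑-++ (x ∷ xs) ys = ≈-trans (+-congˡ (∑-++ xs ys)) (≈-sym (+-assoc _ _ _))

  ∑-partition : {X : Pred Carrier p} {P : Pred (Σ Carrier X) q} (P? : Decidable P) (xs : List (Σ Carrier X)) →
                ∑ A xs ≈ ∑ A (filter P? xs) + ∑ A (filter (¬? ∘ P?) xs)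
  ∑-partition P? [] = ≈-sym (+-identityˡ 0#)
  ∑-partition P? (x ∷ xs) with P? x
  ... | yes _ = ≈-trans (+-congˡ (∑-partition P? xs)) (≈-sym (+-assoc _ _ _))
  ... | no  _ = ≈-trans (+-congˡ (∑-partition P? xs)) (x∙yz≈y∙xz _ _ _)

  -- Meant for `i` the sum over the common part of two finite sets, with `x` and `y` the sums over
  -- the two differences.
  +-cancel-common : ∀ i x y → (i + x) + (i + y) ≈ x + y
  +-cancel-common i x y = begin
    (i + x) + (i + y)  ≈⟨ interchange i x i y ⟩
    (i + i) + (x + y)  ≈⟨ +-congʳ (x+x≈0 A i) ⟩
    0# + (x + y)       ≈⟨ +-identityˡ _ ⟩
    x + y              ∎

module _ (I : DecSetoid c ℓ) where
  open DecSetoid I using (Carrier; setoid)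
  open Membership setoid using (_∈_)

  singleton : Carrier → FiniteSubset I
  singleton x = record
    { subset     = _∈ [ x ]
    ; elements   = [ x ]
    ; unique     = [] ∷ []
    ; enumerates = mk⇔ id id
    }

module _ (em : ExcludedMiddle ℓ₁) (A : AdditivePoset c ℓ₁ ℓ₂)
         (a : AdditivePoset.Carrier A) (tile : IsTile A a) where
  open AdditivePoset A
  open SetoidReasoning setoid
  open RestrictedPowerset (atomsInTail A em a) using (_∆_; _⊑_; _≐_; ∅)
  open FiniteSubset

  private
    module I = DecSetoid (atomsInTail A em a)
    module G = AdditivePoset (generatedByAtoms A a)

  open Membership I.setoid using (_∈_; _∉_)
  open DecMembership (atomsInTail A em a) using (_∈?_)
  open Subset I.setoid using (_⊆_)

  ∉⇒independent-∑ : ∀ x xs → x ∉ xs → Independent A (proj₁ x) (∑ A xs)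
  ∉⇒independent-∑ x []       _    = independent-0 A (proj₁ x)
  ∉⇒independent-∑ x (y ∷ xs) x∉xs =
    independent-+ A (IsTile.independent tile (proj₂ x) (proj₂ y) (x∉xs ∘ here))
                    (∉⇒independent-∑ x xs (x∉xs ∘ there))

  -- Without repetitions, the head is independent of the sum of the rest. By symmetry of
  -- independence, both lie below the total, and induction handles members of the rest.
  ∈⇒≤∑ : ∀ x {xs} → Unique I.setoid xs → x ∈ xs → proj₁ x ≤ ∑ A xs
  ∈⇒≤∑ x {y ∷ xs} (y∉xs ∷ _)   (here x≈y)   =
    ≤-respˡ-≈ (≈-sym x≈y) (∉⇒independent-∑ y xs (All¬⇒¬Any y∉xs))
  ∈⇒≤∑ x {y ∷ xs} (y∉xs ∷ xs!) (there x∈xs) =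
    ≤-trans (∈⇒≤∑ x xs! x∈xs)
      (≤-respʳ-≈ (+-comm _ _) (independent-sym A (∉⇒independent-∑ y xs (All¬⇒¬Any y∉xs))))

  ≤∑⇒∈ : ∀ x xs → proj₁ x ≤ ∑ A xs → x ∈ xs
  ≤∑⇒∈ x xs x≤∑ with x ∈? xs
  ... | yes x∈xs = x∈xs
  ... | no  x∉xs = contradiction (independent-≤⇒≈0 A (∉⇒independent-∑ x xs x∉xs) x≤∑)
                                 (IsAtom.nonzero (proj₁ (proj₂ x)))

  -- Each entry of `xs` lies in the tail of `∑ A ys`, and (∗) closes that tail under addition.
  ⊆⇒∑≤∑ : ∀ xs {ys} → Unique I.setoid ys → xs ⊆ ys → ∑ A xs ≤ ∑ A ys
  ⊆⇒∑≤∑ []       _   _     = 0≤ A _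
  ⊆⇒∑≤∑ (x ∷ xs) ys! xs⊆ys =
    *-law (∈⇒≤∑ x ys! (xs⊆ys {x} (here ≈-refl))) (⊆⇒∑≤∑ xs ys! (λ {y} y∈xs → xs⊆ys {y} (there y∈xs)))

  ∑ₛ : FiniteSubset (atomsInTail A em a) → Carrier
  ∑ₛ J = ∑ A (elements J)

  ∑ₛ-mono : ∀ {J K} → J ⊑ K → ∑ₛ J ≤ ∑ₛ K
  ∑ₛ-mono {J} {K} J⊑K = ⊆⇒∑≤∑ (elements J) (unique K)
    (λ {x} x∈J → Equivalence.to (enumerates K) (J⊑K (Equivalence.from (enumerates J {x}) x∈J)))

  ∑ₛ-cancel : ∀ {J K} → ∑ₛ J ≤ ∑ₛ K → J ⊑ K
  ∑ₛ-cancel {J} {K} ∑J≤∑K {x} x∈J = Equivalence.from (enumerates K)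
    (≤∑⇒∈ x (elements K) (≤-trans (∈⇒≤∑ x (unique J) (Equivalence.to (enumerates J) x∈J)) ∑J≤∑K))

  -- Equal finite subsets may be enumerated in different orders; monotonicity in both directions
  -- with antisymmetry replaces an argument about permutations.
  ∑ₛ-cong : ∀ {J K} → J ≐ K → ∑ₛ J ≈ ∑ₛ K
  ∑ₛ-cong {J} {K} (J⊑K , K⊑J) = ≤-antisym (∑ₛ-mono {J} {K} J⊑K) (∑ₛ-mono {K} {J} K⊑J)

  ∑ₛ-injective : ∀ {J K} → ∑ₛ J ≈ ∑ₛ K → J ≐ K
  ∑ₛ-injective {J} {K} eq =
      ∑ₛ-cancel {J} {K} (≤-reflexive eq) , ∑ₛ-cancel {K} {J} (≤-reflexive (≈-sym eq))

  -- The predicate `subset K` is arbitrary; it inherits compatibility with equality from list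
  -- membership through the enumeration.
  subset-resp : ∀ (K : FiniteSubset (atomsInTail A em a)) {x y} → x I.≈ y → subset K x → subset K y
  subset-resp K {x} {y} x≈y x∈K = Equivalence.from (enumerates K)
    (∈-resp-≈ I.setoid {x = x} {y = y} x≈y (Equivalence.to (enumerates K) x∈K))

  -- The intersection has two enumerations, one along `J` and one along `K`. Exchanging `J` and `K`
  -- gives the reverse inequality, so the two sums agree.
  ∑-∩-≤ : ∀ (J K : FiniteSubset (atomsInTail A em a)) →
          ∑ A (filter (subset? K) (elements J)) ≤ ∑ A (filter (subset? J) (elements K))
  ∑-∩-≤ J K = ⊆⇒∑≤∑ _ (Uniqueₚ.filter⁺ I.setoid (subset? J) (unique K)) λ {x} x∈ →
    let x∈J , x∈K = ∈-filter⁻ I.setoid (subset? K) (λ {y} {z} → subset-resp K {y} {z}) {x} x∈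
    in ∈-filter⁺ I.setoid (subset? J) (λ {y} {z} → subset-resp J {y} {z}) {x}
         (Equivalence.to (enumerates K) x∈K) (Equivalence.from (enumerates J) x∈J)

  -- Each of `J` and `K` splits into the intersection and a difference. The intersection contributes
  -- twice to the right-hand side, hence nothing.
  ∑ₛ-∆ : ∀ J K → ∑ₛ (J ∆ K) ≈ ∑ₛ J + ∑ₛ K
  ∑ₛ-∆ J K = begin
    ∑ A (J∖K ++ K∖J)                     ≈⟨ ∑-++ A J∖K K∖J ⟩
    ∑ A J∖K + ∑ A K∖J                    ≈⟨ +-cancel-common A (∑ A J∩K) _ _ ⟨
    (∑ A J∩K + ∑ A J∖K) + (∑ A J∩K + ∑ A K∖J)
      ≈⟨ +-congˡ (+-congʳ (≤-antisym (∑-∩-≤ J K) (∑-∩-≤ K J))) ⟩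
    (∑ A J∩K + ∑ A J∖K) + (∑ A K∩J + ∑ A K∖J)
      ≈⟨ +-cong (∑-partition A (subset? K) (elements J)) (∑-partition A (subset? J) (elements K)) ⟨
    ∑ₛ J + ∑ₛ K                          ∎
    where
    J∩K = filter (subset? K) (elements J)
    J∖K = filter (¬? ∘ subset? K) (elements J)
    K∩J = filter (subset? J) (elements K)
    K∖J = filter (¬? ∘ subset? J) (elements K)

  -- Sums over finite sets of atoms already form a subspace containing the atoms: `∆` realises
  -- addition, and the only scalars are 0 and 1.
  span⇒∑ₛ : ∀ {x} → Span (vectorSpace (tailPoset A a)) (λ y → AtomsInTail A a (proj₁ y)) x →
            ∃ λ J → ∑ₛ J ≈ proj₁ x
  span⇒∑ₛ (generator {x} x∈I) = singleton (atomsInTail A em a) (proj₁ x , x∈I) , +-identityʳ _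
  span⇒∑ₛ zero                = ∅ , ≈-refl
  span⇒∑ₛ (add s t)           =
    let J , ∑J≈x = span⇒∑ₛ s
        K , ∑K≈y = span⇒∑ₛ t
    in J ∆ K , ≈-trans (∑ₛ-∆ J K) (+-cong ∑J≈x ∑K≈y)
  span⇒∑ₛ (scale 0ℙ s)        = ∅ , ≈-refl
  span⇒∑ₛ (scale 1ℙ s)        = span⇒∑ₛ s
  span⇒∑ₛ (resp x≈y s)        = let J , ∑J≈x = span⇒∑ₛ s in J , ≈-trans ∑J≈x x≈y

  -- Surjectivity between setoids concerns every representative `K` of the preimage, whence the
  -- appeal to `∑ₛ-cong`.
  ∑ₛ-surjective : ∀ (x : G.Carrier) → ∃ λ J → ∀ {K} → K ≐ J → ∑ₛ K ≈ proj₁ (proj₁ x)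
  ∑ₛ-surjective (_ , s) =
    let J , ∑J≈x = span⇒∑ₛ s in J , λ {K} K≐J → ≈-trans (∑ₛ-cong {K} {J} K≐J) ∑J≈x

theorem5p2 : {c ℓ₁ ℓ₂ : Level} (em : ExcludedMiddle ℓ₁) (A : AdditivePoset c ℓ₁ ℓ₂)
    (a : AdditivePoset.Carrier A) → IsTile A a →
    IsAdditivePosetIsomorphism
    (restrictedPowerset (atomsInTail A em a))
    (generatedByAtoms A a)
    (sumMap A em a)
theorem5p2 em A a tile = record
  { isGroupIsomorphism = record
    { isGroupMonomorphism = record
      { isGroupHomomorphism = record
        { isMonoidHomomorphism = record
          { isMagmaHomomorphism = record
            { isRelHomomorphism = record { cong = λ {J} {K} → ∑ₛ-cong em A a tile {J} {K} }
            ; homo              = ∑ₛ-∆ em A a tile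
            }
          ; ε-homo = AdditivePoset.≈-refl A
          }
        -- Negation of finite subsets is the identity, so the sum has to equal its own negative.
        ; ⁻¹-homo = λ J → -x≈x A _
        }
      ; injective = λ {J} {K} → ∑ₛ-injective em A a tile {J} {K}
      }
    ; surjective = ∑ₛ-surjective em A a tile
    }
  ; isOrderIsomorphism = record
    { isOrderMonomorphism = record
      { isOrderHomomorphism = record
        { cong = λ {J} {K} → ∑ₛ-cong em A a tile {J} {K}
        ; mono = λ {J} {K} → ∑ₛ-mono em A a tile {J} {K}
        }
      ; injective = λ {J} {K} → ∑ₛ-injective em A a tile {J} {K}
      ; cancel    = λ {J} {K} → ∑ₛ-cancel em A a tile {J} {K}
      }
    ; surjective = ∑ₛ-surjective em A a tile
    }
  }
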